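{- Let $r \geq 1$, let $H$ be a graph, let $S \subseteq V(H)$ be a vertex cover of $H$, and let $G = \mathrm{CCG}(H, S, r)$. Then the $r$-independence complex $\mathrm{Ind}_r(G)$ is shellable.
   Context: All graphs are finite and simple. A vertex cover of $H$ is a set $S\subseteq V(H)$ containing at least one endpoint of every edge. A star-clique graph $\mathrm{SC}(x)$ is a graph formed by attaching a collection of cliques $B_1,\dots,B_t$ (complete graphs, possibly of different sizes) to a central vertex $x$, i.e. each $B_i$ contains $x$ and the $B_i$ share no other vertices. $\mathrm{CCG}(H,S,r)$ is the graph obtained from $H$ by attaching to each vertex $x \in S$ a star-clique graph $\mathrm{SC}(x)$ with center $x$ and $|V(\mathrm{SC}(x))| \geq r+1$, whose vertices other than $x$ are new (not in $H$ and not in any other attached star-clique). For $r \geq 1$, a subset $A \subseteq V(G)$ is $r$-independent if every connected component of $G[A]$ has at most $r$ vertices; $\mathrm{Ind}_r(G)$ is the simplicial complex on $V(G)$ of all $r$-independent subsets. A (not necessarily pure) simplicial complex is shellable if its facets can be ordered $F_1,\dots,F_t$ so that for each $k>1$, $\langle F_k\rangle \cap \langle F_1,\dots,F_{k-1}\rangle$ is pure of dimension $\dim F_k-1$ ($\langle\mathcal F\rangle$ = complex generated by $\mathcal F$). -}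

module Defs where

open import Data.Nat using (ℕ; _≤_; _+_; _∸_)
open import Data.Bool using (Bool; true; false; not; T)
open import Data.Fin using (Fin)
open import Data.Fin.Properties using (_≟_)
open import Data.Fin.Subset using (Subset; _∈_; _∉_)
open import Data.List using (List; []; _∷_; _++_; length; tabulate)
open import Data.Nat.ListAction using (sum)
open import Data.List.Membership.Propositional using () renaming (_∈_ to _∈ₗ_)
open import Data.List.Relation.Binary.Subset.Propositional using (_⊆_)
open import Data.List.Relation.Unary.All using (All)
open import Data.List.Relation.Unary.Any using (Any)
open import Data.List.Relation.Unary.AllPairs using (AllPairs)
open import Data.List.Relation.Unary.Unique.Propositional using (Unique)
open import Data.Product using (Σ; _×_; ∃; _,_)
open import Data.Sum using (_⊎_; inj₁; inj₂)
open import Relation.Nullary using (¬_; yes; no)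
open import Relation.Nullary.Decidable using (isYes)
open import Relation.Binary.PropositionalEquality using (_≡_; _≢_; refl)

record FinGraph (n : ℕ) : Set where
  field
    adj    : Fin n → Fin n → Bool
    sym    : ∀ u v → adj u v ≡ adj v u
    irrefl : ∀ v → adj v v ≡ false

open FinGraph public

IsVertexCover : ∀ {n} → FinGraph n → Subset n → Set
IsVertexCover {n} H S = ∀ (u v : Fin n) → T (adj H u v) → u ∈ S ⊎ v ∈ S

-- CCG(H, S, r).
-- For each x : Fin n, t x is the number of cliques B_1..B_{t x} attached
-- at x, and k x i is the number of NEW vertices of B_i (so |B_i| = 1 + k x i).
-- The vertex set of the resulting graph is V(H) ⊎ {new vertices}.

CCGVertex : (n : ℕ) (t : Fin n → ℕ) (k : (x : Fin n) → Fin (t x) → ℕ) → Set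
CCGVertex n t k = Fin n ⊎ Σ (Fin n) (λ x → Σ (Fin (t x)) (λ i → Fin (k x i)))

ccgAdj : ∀ {n} (H : FinGraph n) (t : Fin n → ℕ) (k : (x : Fin n) → Fin (t x) → ℕ) →
         CCGVertex n t k → CCGVertex n t k → Bool
ccgAdj H t k (inj₁ u) (inj₁ v) = adj H u v
ccgAdj H t k (inj₁ u) (inj₂ (x , _ , _)) = isYes (u ≟ x)
ccgAdj H t k (inj₂ (x , _ , _)) (inj₁ u) = isYes (x ≟ u)
ccgAdj H t k (inj₂ (x , i , a)) (inj₂ (y , j , b)) with x ≟ y
... | no _ = false
... | yes refl with i ≟ j
...   | no _ = false
...   | yes refl = not (isYes (a ≟ b))

-- The data (t, k) describe star-clique graphs attached exactly at the
-- vertices of S, each SC(x) having at least r+1 vertices.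
IsCCGData : ∀ {n} → Subset n → ℕ → (t : Fin n → ℕ) → ((x : Fin n) → Fin (t x) → ℕ) → Set
IsCCGData {n} S r t k =
  (∀ (x : Fin n) → x ∉ S → t x ≡ 0) ×
  (∀ (x : Fin n) → x ∈ S → r + 1 ≤ 1 + sum (tabulate (k x)))

module _ {V : Set} (adjG : V → V → Bool) where

  data Conn (A : List V) (u : V) : V → Set where
    here : u ∈ₗ A → Conn A u u
    step : ∀ {v w} → Conn A u v → w ∈ₗ A → T (adjG v w) → Conn A u w

  RIndependent : ℕ → List V → Set
  RIndependent r A = ∀ (u : V) (B : List V) → Unique B → All (Conn A u) B → length B ≤ r

-- A simplicial complex on V is given by a predicate on (duplicate-free)
-- lists of vertices, read as finite sets.
Complex : Set → Set₁
Complex V = List V → Set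

IndR : ∀ {V : Set} → (V → V → Bool) → ℕ → Complex V
IndR adjG r A = RIndependent adjG r A

module _ {V : Set} where

  _≋_ : List V → List V → Set
  A ≋ B = A ⊆ B × B ⊆ A

  IsFace : Complex V → List V → Set
  IsFace Δ σ = Unique σ × Δ σ

  IsFacet : Complex V → List V → Set
  IsFacet Δ F = IsFace Δ F × (∀ σ → IsFace Δ σ → F ⊆ σ → σ ⊆ F)

  PureCard : Complex V → ℕ → Set
  PureCard Δ d = ∀ σ → IsFacet Δ σ → length σ ≡ d

  Intersect : List V → List (List V) → Complex V
  Intersect F prev σ = σ ⊆ F × Any (σ ⊆_) prev

  ShellingCondition : List (List V) → Set
  ShellingCondition Fs = ∀ (prev : List (List V)) (F : List V) (rest : List (List V)) →
    Fs ≡ prev ++ F ∷ rest → prev ≢ [] →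
    PureCard (Intersect F prev) (length F ∸ 1)

  Shellable : Complex V → Set
  Shellable Δ = ∃ λ (Fs : List (List V)) →
    All (IsFacet Δ) Fs ×
    (∀ F → IsFacet Δ F → Any (F ≋_) Fs) ×
    AllPairs (λ F G → ¬ (F ≋ G)) Fs ×
    ShellingCondition Fs

{-# OPTIONS --safe #-}

-- The facets are listed by branching on the vertices in the order S, V(H) ∖ S,
-- new vertices, the branch omitting a vertex v coming before the one using it.
-- This is a shelling provided that at every stage v is either a cone point or a
-- shedding vertex: whenever v ∷ F is a face, some undecided w ∉ F can replace v.
-- Let K be the component of v in v ∷ F, so |K| ≤ r.  If v ∈ S, then SC(v) has more
-- than r vertices and hence a new vertex w outside F.  If v ∉ S and the component
-- of v among all chosen and undecided vertices has at most r vertices, then v is a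
-- cone point; otherwise some undecided w ∉ F is adjacent to K.  If this w is not
-- new, then w ∉ S, so its neighbour in K lies in S, and the star-clique there
-- supplies a new w.  New vertices are simplicial, so all neighbours of w in F lie
-- in K, and the component of w in w ∷ F is contained in (K ∖ v) ∪ w.
module Submission where

open import Defs hiding (sym; irrefl)
open import Data.Bool using (Bool; T)
open import Data.Bool.Properties using (T?)
open import Data.Fin using (Fin; zero; suc)
import Data.Fin.Properties as Fin
open import Data.Fin.Subset using (Subset) renaming (_∈_ to _∈ˢ_; _∉_ to _∉ˢ_)
open import Data.Fin.Subset.Properties using () renaming (_∈?_ to _∈ˢ?_)
open import Data.List using (List; []; _∷_; [_]; _++_; length; filter; concat; tabulate; map; allFin)
open import Data.List.Membership.Propositional using (_∈_; _∉_; find)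
import Data.List.Membership.DecPropositional as DecMembership
open import Data.List.Membership.Propositional.Properties
  using (∈-filter⁺; ∈-filter⁻; ∈-++⁺ˡ; ∈-++⁺ʳ; ∈-++⁻; ∈-map⁺; ∈-map⁻; ∈-concat⁺′; ∈-concat⁻′;
         ∈-tabulate⁺; ∈-tabulate⁻; ∈-allFin)
open import Data.List.Properties using (++-assoc; ++-identityʳ; filter-notAll; length-++; length-tabulate; tabulate-cong)
open import Data.List.Relation.Binary.Subset.Propositional using (_⊆_)
open import Data.List.Relation.Binary.Subset.Propositional.Properties using (∷⁺ʳ)
open import Data.List.Relation.Unary.All as All using (All; []; _∷_)
import Data.List.Relation.Unary.All.Properties as All
open import Data.List.Relation.Unary.AllPairs as AllPairs using (AllPairs; []; _∷_)
import Data.List.Relation.Unary.AllPairs.Properties as AllPairs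
open import Data.List.Relation.Unary.Any as Any using (Any; here; there; any?)
import Data.List.Relation.Unary.Any.Properties as Any
open import Data.List.Relation.Unary.Unique.Propositional using (Unique)
import Data.List.Relation.Unary.Unique.Propositional.Properties as Unique
open import Data.Nat using (ℕ; zero; suc; _+_; _∸_; _≤_; _<_; z≤n; s≤s; pred)
open import Data.Nat.ListAction using (sum)
open import Data.Nat.Properties
  using (≤-trans; ≤-reflexive; ≤-antisym; ≤-pred; <⇒≱; m≤m+n; +-identityʳ; +-suc; +-comm; suc-injective)
open import Data.Product using (∃; ∃₂; _×_; _,_; proj₁; proj₂)
import Data.Product.Properties as Product
open import Data.Sum using (_⊎_; inj₁; inj₂)
import Data.Sum as Sum
import Data.Sum.Properties as Sum
open import Function using (_∘_; id)
open import Relation.Binary using (DecidableEquality)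
open import Relation.Binary.PropositionalEquality
  using (_≡_; _≢_; refl; sym; trans; cong; subst)
open import Relation.Nullary using (¬_; Dec; yes; no; contradiction)
open import Relation.Nullary.Decidable using (¬?; _×-dec_; map′; decidable-stable; toWitness; fromWitness)

-- Duplicate-free lists as finite sets.

All-⊎-const : ∀ {A Q : Set} {P : A → Set} {xs} → All (λ x → P x ⊎ Q) xs → All P xs ⊎ Q
All-⊎-const []              = inj₁ []
All-⊎-const (inj₂ q ∷ _)    = inj₂ q
All-⊎-const (inj₁ p ∷ pqs)  = Sum.map₁ (p ∷_) (All-⊎-const pqs)

Unique-∷ : ∀ {A : Set} {x : A} {xs} → x ∉ xs → Unique xs → Unique (x ∷ xs)
Unique-∷ x∉xs xs! = All.tabulate (λ { y∈xs refl → x∉xs y∈xs }) ∷ xs!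

module FiniteSets {V : Set} (_≟_ : DecidableEquality V) where

  open DecMembership _≟_ using (_∈?_) public

  infixl 6 _-_

  _-_ : List V → V → List V
  F - v = filter (λ y → ¬? (y ≟ v)) F

  ∈-remove⁺ : ∀ {F v y} → y ∈ F → y ≢ v → y ∈ F - v
  ∈-remove⁺ = ∈-filter⁺ _

  ∈-remove⁻ : ∀ {F v y} → y ∈ F - v → y ∈ F × y ≢ v
  ∈-remove⁻ {F} = ∈-filter⁻ _ {xs = F}

  remove! : ∀ {F} v → Unique F → Unique (F - v)
  remove! v = Unique.filter⁺ _

  ⊆-∷-remove : ∀ F v → F ⊆ v ∷ (F - v)
  ⊆-∷-remove F v {y} y∈F with y ≟ v
  ... | yes refl = here refl
  ... | no y≢v   = there (∈-remove⁺ y∈F y≢v)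

  length-remove-< : ∀ {F v} → v ∈ F → length (F - v) < length F
  length-remove-< {F} v∈F = filter-notAll _ F (Any.map (λ v≡y y≢v → y≢v (sym v≡y)) v∈F)

  Unique-⊆-length : ∀ {xs ys : List V} → Unique xs → xs ⊆ ys → length xs ≤ length ys
  Unique-⊆-length []              _     = z≤n
  Unique-⊆-length {x ∷ _} (x≢ ∷ xs!) xs⊆ys = ≤-trans
    (s≤s (Unique-⊆-length xs! (λ y∈xs → ∈-remove⁺ (xs⊆ys (there y∈xs)) (λ { refl → All.lookup x≢ y∈xs refl }))))
    (length-remove-< (xs⊆ys (here refl)))

  length-remove : ∀ {F v} → Unique F → v ∈ F → length (F - v) ≡ length F ∸ 1
  length-remove {F} {v} F! v∈F =
    cong pred (≤-antisym (length-remove-< v∈F) (Unique-⊆-length F! (⊆-∷-remove F v)))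

  -- Shelling orders through an exchange property.

  -- The exchange form of the shelling condition: as `v ∉ G`, the set `F - v` contains the
  -- intersection of `F` with `G`; it has one vertex less than `F` and lies in an earlier facet.
  ShellingStep : List (List V) → List V → Set
  ShellingStep prev F = ∀ {G} → G ∈ prev →
    ∃ λ v → v ∈ F × v ∉ G × ∃ λ G′ → G′ ∈ prev × F - v ⊆ G′

  -- The prefix `prev` is an index, so that blocks of facets from separate branches can be shelled
  -- on their own and then joined.
  data ShelledAfter : List (List V) → List (List V) → Set where
    []  : ∀ {prev} → ShelledAfter prev []
    _∷_ : ∀ {prev F Fs} → ShellingStep prev F → ShelledAfter (prev ++ [ F ]) Fs →
          ShelledAfter prev (F ∷ Fs)

  ShellingStep-++ : ∀ {As Bs F} → ShellingStep As F → ShellingStep Bs F → ShellingStep (As ++ Bs) F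
  ShellingStep-++ {As} stepA stepB G∈ with ∈-++⁻ As G∈
  ... | inj₁ G∈A = let v , v∈F , v∉G , G′ , G′∈ , sub = stepA G∈A
                   in  v , v∈F , v∉G , G′ , ∈-++⁺ˡ G′∈ , sub
  ... | inj₂ G∈B = let v , v∈F , v∉G , G′ , G′∈ , sub = stepB G∈B
                   in  v , v∈F , v∉G , G′ , ∈-++⁺ʳ As G′∈ , sub

  ShelledAfter-++ : ∀ {prev As Bs} → ShelledAfter prev As → ShelledAfter (prev ++ As) Bs →
                    ShelledAfter prev (As ++ Bs)
  ShelledAfter-++ {prev} {Bs = Bs} [] shB =
    subst (λ ps → ShelledAfter ps Bs) (++-identityʳ prev) shB
  ShelledAfter-++ {prev} {A ∷ As} {Bs} (st ∷ shA) shB =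
    st ∷ ShelledAfter-++ shA (subst (λ ps → ShelledAfter ps Bs) (sym (++-assoc prev [ A ] As)) shB)

  -- Earlier facets are compared with `F` one at a time, and a witness `G′` survives any enlargement
  -- of the prefix. Hence steps against `As` and steps against `prev` combine.
  ShelledAfter-weaken : ∀ {As prev Fs} → All (ShellingStep As) Fs → ShelledAfter prev Fs →
                        ShelledAfter (As ++ prev) Fs
  ShelledAfter-weaken [] [] = []
  ShelledAfter-weaken {As} {prev} {F ∷ Fs} (stA ∷ stAs) (st ∷ sh) =
    ShellingStep-++ {As} {prev} stA st
    ∷ subst (λ ps → ShelledAfter ps Fs) (sym (++-assoc As prev [ F ])) (ShelledAfter-weaken stAs sh)

  ShelledAfter⇒step : ∀ {prev} mid {F rest} → ShelledAfter prev (mid ++ F ∷ rest) →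
                      ShellingStep (prev ++ mid) F
  ShelledAfter⇒step {prev} [] {F} (st ∷ _) =
    subst (λ ps → ShellingStep ps F) (sym (++-identityʳ prev)) st
  ShelledAfter⇒step {prev} (A ∷ mid) {F} (_ ∷ sh) =
    subst (λ ps → ShellingStep ps F) (++-assoc prev [ A ] mid) (ShelledAfter⇒step mid sh)

  -- A maximal face `σ` of the intersection lies in `F` and in some earlier `G`, hence in `F - v`.
  -- Since `F - v` is itself a face of the intersection, maximality makes the two equal as sets.
  ShellingStep⇒pure : ∀ {prev F} → Unique F → ShellingStep prev F →
                      PureCard (Intersect F prev) (length F ∸ 1)
  ShellingStep⇒pure {prev} {F} F! st σ ((σ! , σ⊆F , σ⊆prev) , maximal)
    with G , G∈ , σ⊆G ← find σ⊆prev
    with v , v∈F , v∉G , G′ , G′∈ , sub ← st G∈ =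
    trans (≤-antisym (Unique-⊆-length σ! σ⊆F-v) (Unique-⊆-length (remove! v F!) F-v⊆σ))
          (length-remove F! v∈F)
    where
    σ⊆F-v : σ ⊆ F - v
    σ⊆F-v y∈σ = ∈-remove⁺ (σ⊆F y∈σ) (λ { refl → v∉G (σ⊆G y∈σ) })
    F-v⊆σ : F - v ⊆ σ
    F-v⊆σ = maximal (F - v)
      (remove! v F! , proj₁ ∘ ∈-remove⁻ , Any.map (λ { refl {_} → sub }) G′∈) σ⊆F-v

-- Vertex decompositions and the facet lists they produce.

-- Here T is the set of vertices already put into a face and U the list of
-- vertices still undecided, so the complex at hand is link(T) restricted to U.
module Decompositions {V : Set} (_≟_ : DecidableEquality V)
  (P : Complex V) (P? : ∀ A → Dec (P A)) (P-⊆ : ∀ {A B} → A ⊆ B → P B → P A) where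

  open FiniteSets _≟_

  Between : List V → List V → List V → Set
  Between T U F = T ⊆ F × (∀ {y} → y ∈ F → y ∈ T ⊎ y ∈ U)

  -- Maximality is tested by single vertices, which suffices because `P` passes to subsets.
  record Facet (T U F : List V) : Set where
    constructor facet
    field
      unique  : Unique F
      between : Between T U F
      face    : P F
      maximal : ∀ {w} → w ∈ U → w ∉ F → ¬ P (w ∷ F)

  -- Nonpure vertex decomposability as a tree: `cone` keeps only the link of `v`, while `shed` has
  -- the deletion first and the link second. `T` need not be a face; leaves below a non-face
  -- contribute no facets.
  data Decomposition : List V → List V → Set where
    []   : ∀ {T} → Decomposition T []
    cone : ∀ {T U v} → v ∉ T → v ∉ U →
           (∀ {F} → Between T U F → P F → P (v ∷ F)) →
           Decomposition (v ∷ T) U → Decomposition T (v ∷ U)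
    shed : ∀ {T U v} → v ∉ T → v ∉ U →
           (∀ {F} → Between T U F → P (v ∷ F) → ∃ λ w → w ∈ U × w ∉ F × P (w ∷ F)) →
           Decomposition T U → Decomposition (v ∷ T) U → Decomposition T (v ∷ U)

  Between-shift : ∀ {T U F v} → v ∈ F → Between T (v ∷ U) F → Between (v ∷ T) U F
  Between-shift {T} {U} {F} {v} v∈F (T⊆F , F⊆) = sub , cases ∘ F⊆
    where
    sub : v ∷ T ⊆ F
    sub (here refl) = v∈F
    sub (there y∈T) = T⊆F y∈T
    cases : ∀ {y} → y ∈ T ⊎ y ∈ v ∷ U → y ∈ v ∷ T ⊎ y ∈ U
    cases (inj₁ y∈T)         = inj₁ (there y∈T)
    cases (inj₂ (here refl)) = inj₁ (here refl)
    cases (inj₂ (there y∈U)) = inj₂ y∈U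

  Between-unshift : ∀ {T U F v} → Between (v ∷ T) U F → Between T (v ∷ U) F
  Between-unshift {T} {U} {F} {v} (vT⊆F , F⊆) = vT⊆F ∘ there , cases ∘ F⊆
    where
    cases : ∀ {y} → y ∈ v ∷ T ⊎ y ∈ U → y ∈ T ⊎ y ∈ v ∷ U
    cases (inj₁ (here refl)) = inj₂ (here refl)
    cases (inj₁ (there y∈T)) = inj₁ y∈T
    cases (inj₂ y∈U)         = inj₂ (there y∈U)

  Between-drop : ∀ {T U F v} → v ∉ F → Between T (v ∷ U) F → Between T U F
  Between-drop {T} {U} {F} {v} v∉F (T⊆F , F⊆) = T⊆F , λ y∈F → cases y∈F (F⊆ y∈F)
    where
    cases : ∀ {y} → y ∈ F → y ∈ T ⊎ y ∈ v ∷ U → y ∈ T ⊎ y ∈ U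
    cases _   (inj₁ y∈T)         = inj₁ y∈T
    cases y∈F (inj₂ (here refl)) = contradiction y∈F v∉F
    cases _   (inj₂ (there y∈U)) = inj₂ y∈U

  Facet-shift : ∀ {T U F v} → v ∈ F → Facet T (v ∷ U) F → Facet (v ∷ T) U F
  Facet-shift v∈F (facet F! btw face max) = facet F! (Between-shift v∈F btw) face (max ∘ there)

  Facet-unshift : ∀ {T U F v} → Facet (v ∷ T) U F → Facet T (v ∷ U) F
  Facet-unshift (facet F! btw face max) = facet F! (Between-unshift btw) face λ where
    (here refl) v∉F → contradiction (proj₁ btw (here refl)) v∉F
    (there w∈U) → max w∈U

  Facet-drop : ∀ {T U F v} → v ∉ F → Facet T (v ∷ U) F → Facet T U F
  Facet-drop v∉F (facet F! btw face max) = facet F! (Between-drop v∉F btw) face (max ∘ there)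

  Facet-undrop : ∀ {T U F v} → (v ∉ F → ¬ P (v ∷ F)) → Facet T U F → Facet T (v ∷ U) F
  Facet-undrop ¬Pv (facet F! (T⊆F , F⊆) face max) = facet F! (T⊆F , Sum.map₂ there ∘ F⊆) face λ where
    (here refl) → ¬Pv
    (there w∈U) → max w∈U

  ∉-between : ∀ {T U F v} → v ∉ T → v ∉ U → Between T U F → v ∉ F
  ∉-between v∉T v∉U (_ , F⊆) v∈F = Sum.[ v∉T , v∉U ] (F⊆ v∈F)

  -- One pass through `U` is enough: a vertex rejected because `w ∷ A` is not a face stays rejected,
  -- as the face only grows and `P` passes to subsets.
  greedy : ∀ U A → Unique A → P A → ∃ λ F → Facet A U F
  greedy [] A A! PA = A , facet A! (id , inj₁) PA λ ()
  greedy (w ∷ U) A A! PA with w ∈? A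
  ... | yes w∈A = let F , fac = greedy U A A! PA
                  in  F , Facet-undrop (λ w∉F → contradiction (proj₁ (Facet.between fac) w∈A) w∉F) fac
  ... | no w∉A with P? (w ∷ A)
  ...   | yes Pw = let F , fac = greedy U (w ∷ A) (Unique-∷ w∉A A!) Pw in F , Facet-unshift fac
  ...   | no ¬Pw = let F , fac = greedy U A A! PA
                   in  F , Facet-undrop (λ _ → ¬Pw ∘ P-⊆ (∷⁺ʳ _ (proj₁ (Facet.between fac)))) fac

  extend : ∀ {T U A} → Unique A → Between T U A → P A → ∃ λ F → Facet T U F × A ⊆ F
  extend {T} {U} {A} A! (T⊆A , A⊆) PA =
    let F , facet F! (A⊆F , F⊆) face max = greedy U A A! PA
    in  F , facet F! (A⊆F ∘ T⊆A , Sum.[ A⊆ , inj₂ ] ∘ F⊆) face max , A⊆F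

  facets : ∀ {T U} → Decomposition T U → List (List V)
  facets {T} [] with P? T
  ... | yes _ = [ T ]
  ... | no _  = []
  facets (cone _ _ _ d)     = facets d
  facets (shed _ _ _ d₁ d₂) = facets d₁ ++ facets d₂

  -- In the deletion branch the shedding condition keeps facets maximal: were `v ∷ F` a face, some
  -- `w` in `U` outside `F` could be added to `F`.
  facets-sound : ∀ {T U} (d : Decomposition T U) → Unique T → All (Facet T U) (facets d)
  facets-sound {T} [] T! with P? T
  ... | yes PT = facet T! (id , inj₁) PT (λ ()) ∷ []
  ... | no _   = []
  facets-sound (cone v∉T _ _ d) T! = All.map Facet-unshift (facets-sound d (Unique-∷ v∉T T!))
  facets-sound (shed {T} {U} {v} v∉T v∉U ex d₁ d₂) T! = All.++⁺
    (All.map (λ fac → Facet-undrop (λ _ → ¬Pv fac) fac) (facets-sound d₁ T!))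
    (All.map Facet-unshift (facets-sound d₂ (Unique-∷ v∉T T!)))
    where
    ¬Pv : ∀ {F} → Facet T U F → ¬ P (v ∷ F)
    ¬Pv fac Pv = let w , w∈U , w∉F , Pw = ex (Facet.between fac) Pv
                 in  Facet.maximal fac w∈U w∉F Pw

  facets-complete : ∀ {T U} (d : Decomposition T U) → ∀ {F} → Facet T U F → Any (F ≋_) (facets d)
  facets-complete {T} [] {F} (facet _ (T⊆F , F⊆) PF _) with P? T
  ... | yes _  = here (Sum.[ id , (λ ()) ] ∘ F⊆ , T⊆F)
  ... | no ¬PT = contradiction (P-⊆ T⊆F PF) ¬PT
  facets-complete (cone {v = v} v∉T v∉U co d) {F} fac with v ∈? F
  ... | yes v∈F = facets-complete d (Facet-shift v∈F fac)
  -- A facet avoiding a cone point could be enlarged by it.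
  ... | no v∉F  = contradiction (co (Between-drop v∉F (Facet.between fac)) (Facet.face fac))
                                (Facet.maximal fac (here refl) v∉F)
  facets-complete (shed {v = v} v∉T v∉U ex d₁ d₂) {F} fac with v ∈? F
  ... | yes v∈F = Any.++⁺ʳ (facets d₁) (facets-complete d₂ (Facet-shift v∈F fac))
  ... | no v∉F  = Any.++⁺ˡ (facets-complete d₁ (Facet-drop v∉F fac))

  facets-distinct : ∀ {T U} (d : Decomposition T U) → Unique T →
                    AllPairs (λ F G → ¬ (F ≋ G)) (facets d)
  facets-distinct {T} [] T! with P? T
  ... | yes _ = [] ∷ []
  ... | no _  = []
  facets-distinct (cone v∉T _ _ d) T! = facets-distinct d (Unique-∷ v∉T T!)
  facets-distinct (shed v∉T v∉U ex d₁ d₂) T! = AllPairs.++⁺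
    (facets-distinct d₁ T!) (facets-distinct d₂ (Unique-∷ v∉T T!))
    (All.map (λ facF → All.map (λ facG F≋G →
        ∉-between v∉T v∉U (Facet.between facF)
          (proj₂ F≋G (proj₁ (Facet.between facG) (here refl))))
      (facets-sound d₂ (Unique-∷ v∉T T!)))
    (facets-sound d₁ T!))

  -- Both branches are shelled by recursion. Between a facet of the link branch and any facet of the
  -- deletion branch, the exchanged vertex is always `v`.
  facets-shelled : ∀ {T U} (d : Decomposition T U) → Unique T → ShelledAfter [] (facets d)
  facets-shelled {T} [] T! with P? T
  ... | yes _ = (λ ()) ∷ []
  ... | no _  = []
  facets-shelled (cone v∉T _ _ d) T! = facets-shelled d (Unique-∷ v∉T T!)
  facets-shelled (shed {T} {U} {v} v∉T v∉U ex d₁ d₂) T! =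
    ShelledAfter-++ (facets-shelled d₁ T!)
      (subst (λ ps → ShelledAfter ps (facets d₂)) (++-identityʳ (facets d₁))
        (ShelledAfter-weaken (All.map cross (facets-sound d₂ vT!)) (facets-shelled d₂ vT!)))
    where
    vT! = Unique-∷ v∉T T!
    -- F - v is a face avoiding v, so it lies in one of the facets avoiding v.
    cross : ∀ {F} → Facet (v ∷ T) U F → ShellingStep (facets d₁) F
    cross {F} fac G∈ =
      let facet F! (vT⊆F , F⊆) PF _ = fac
          btw : Between T U (F - v)
          btw = (λ y∈T → ∈-remove⁺ (vT⊆F (there y∈T)) (λ { refl → v∉T y∈T }))
              , λ y∈ → let y∈F , y≢v = ∈-remove⁻ y∈
                       in  Sum.map₁ (λ { (here y≡v) → contradiction y≡v y≢v ; (there y∈T) → y∈T }) (F⊆ y∈F)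
          _ , facF′ , F-v⊆F′ = extend (remove! v F!) btw (P-⊆ (proj₁ ∘ ∈-remove⁻) PF)
          G′ , G′∈ , F′⊆G′ , _ = find (facets-complete d₁ facF′)
      in  v , vT⊆F (here refl)
            , ∉-between v∉T v∉U (Facet.between (All.lookup (facets-sound d₁ T!) G∈))
            , G′ , G′∈ , F′⊆G′ ∘ F-v⊆F′

  Facet⇒IsFacet : ∀ {U} → (∀ v → v ∈ U) → ∀ {F} → Facet [] U F → IsFacet P F
  Facet⇒IsFacet U-total {F} (facet F! _ PF max) = (F! , PF) , λ σ (_ , Pσ) F⊆σ {y} y∈σ →
    decidable-stable (y ∈? F) λ y∉F → max (U-total y) y∉F
      (P-⊆ (λ { (here refl) → y∈σ ; (there z∈F) → F⊆σ z∈F }) Pσ)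

  IsFacet⇒Facet : ∀ {U} → (∀ v → v ∈ U) → ∀ {F} → IsFacet P F → Facet [] U F
  IsFacet⇒Facet U-total {F} ((F! , PF) , max) = facet F! ((λ ()) , λ _ → inj₂ (U-total _)) PF
    λ {w} _ w∉F Pw → w∉F (max (w ∷ F) (Unique-∷ w∉F F! , Pw) there (here refl))

  decomposition⇒shellable : ∀ {U} → (∀ v → v ∈ U) → Decomposition [] U → Shellable P
  decomposition⇒shellable U-total d =
      facets d
    , All.map (Facet⇒IsFacet U-total) sound
    , (λ F isFacet → facets-complete d (IsFacet⇒Facet U-total isFacet))
    , facets-distinct d []
    , λ prev F rest eq _ → ShellingStep⇒pure
        (Facet.unique (All.lookup (subst (All _) eq sound) (∈-++⁺ʳ prev (here refl))))
        (ShelledAfter⇒step prev (subst (ShelledAfter []) eq (facets-shelled d [])))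
    where
    sound = facets-sound d []

-- Components of induced subgraphs and r-independence.

module IndependenceComplex {V : Set} (_≟_ : DecidableEquality V) (E : V → V → Bool)
  (E-sym : ∀ {u v} → T (E u v) → T (E v u)) (E-irrefl : ∀ {v} → ¬ T (E v v)) (r : ℕ) where

  open FiniteSets _≟_

  -- `Large` refutes `Small` by an explicit list of vertices, whose connecting walks are inspected
  -- later.
  Small Large : List V → V → Set
  Small A u = ∀ B → Unique B → All (Conn E A u) B → length B ≤ r
  Large A u = ∃ λ B → Unique B × All (Conn E A u) B × r < length B

  Conn-source : ∀ {A u v} → Conn E A u v → u ∈ A
  Conn-source (here u∈A)   = u∈A
  Conn-source (step p _ _) = Conn-source p

  Conn-target : ∀ {A u v} → Conn E A u v → v ∈ A
  Conn-target (here u∈A)     = u∈A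
  Conn-target (step _ w∈A _) = w∈A

  Conn-trans : ∀ {A u v w} → Conn E A u v → Conn E A v w → Conn E A u w
  Conn-trans p (here _)       = p
  Conn-trans p (step q w∈A e) = step (Conn-trans p q) w∈A e

  Conn-sym : ∀ {A u v} → Conn E A u v → Conn E A v u
  Conn-sym (here u∈A)     = here u∈A
  Conn-sym (step p w∈A e) = Conn-trans (step (here w∈A) (Conn-target p) (E-sym e)) (Conn-sym p)

  Conn-mono : ∀ {A B u v} → A ⊆ B → Conn E A u v → Conn E B u v
  Conn-mono A⊆B (here u∈A)     = here (A⊆B u∈A)
  Conn-mono A⊆B (step p w∈A e) = step (Conn-mono A⊆B p) (A⊆B w∈A) e

  Small-mono : ∀ {A B u} → A ⊆ B → Small B u → Small A u
  Small-mono A⊆B small C C! conn = small C C! (All.map (Conn-mono A⊆B) conn)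

  independent-⊆ : ∀ {A B} → A ⊆ B → RIndependent E r B → RIndependent E r A
  independent-⊆ A⊆B ind u = Small-mono A⊆B (ind u)

  -- Exploration of the component of `u`: `C` holds vertices reached so far and `m` is the number
  -- missing to r + 1. If no edge leaves `C` within `A`, then `C` is the whole component; otherwise
  -- one more vertex is reached, until `m` is zero.
  grow : ∀ {A u} m C → Unique C → All (Conn E A u) C → u ∈ C → length C + m ≡ suc r →
         Small A u ⊎ Large A u
  grow zero C C! conn _ len = inj₂ (C , C! , conn , ≤-reflexive (trans (sym len) (+-identityʳ _)))
  grow {A} {u} (suc m) C C! conn u∈C len
    with any? (λ w → ¬? (w ∈? C) ×-dec any? (λ z → T? (E z w)) C) A
  ... | yes found =
    let w , w∈A , w∉C , nbr = find found
        z , z∈C , e = find nbr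
    in  grow m (w ∷ C) (Unique-∷ w∉C C!) (step (All.lookup conn z∈C) w∈A e ∷ conn) (there u∈C)
             (trans (sym (+-suc (length C) m)) len)
  ... | no none = inj₁ λ B B! connB → ≤-trans
          (Unique-⊆-length B! (closed ∘ All.lookup connB))
          (≤-trans (m≤m+n _ m) (≤-reflexive (suc-injective (trans (sym (+-suc (length C) m)) len))))
    where
    closed : ∀ {b} → Conn E A u b → b ∈ C
    closed (here _) = u∈C
    closed (step {w = w} p w∈A e) = decidable-stable (w ∈? C) λ w∉C →
      none (Any.map (λ { refl → w∉C , Any.map (λ { refl → e }) (closed p) }) w∈A)

  small⊎large : ∀ {A u} → u ∈ A → Small A u ⊎ Large A u
  small⊎large {u = u} u∈A = grow r [ u ] ([] ∷ []) (here u∈A ∷ []) (here refl) refl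

  small? : ∀ {A u} → u ∈ A → Dec (Small A u)
  small? u∈A with small⊎large u∈A
  ... | inj₁ small = yes small
  ... | inj₂ (B , B! , conn , r<) = no λ small → <⇒≱ r< (small B B! conn)

  independent? : ∀ A → Dec (RIndependent E r A)
  independent? A = map′ to (λ ind → All.tabulate (λ {u} _ → ind u)) (All-dec A id)
    where
    to : All (Small A) A → RIndependent E r A
    to smalls u []      _  _             = z≤n
    -- A nonempty list connected to `u` forces `u ∈ A`, so testing the vertices of `A` is enough.
    to smalls u (b ∷ B) B! conn@(c ∷ _) = All.lookup smalls (Conn-source c) (b ∷ B) B! conn
    All-dec : ∀ C → C ⊆ A → Dec (All (Small A) C)
    All-dec []      _   = yes []
    All-dec (c ∷ C) C⊆A = map′ (λ (s , ss) → s ∷ ss) (λ { (s ∷ ss) → s , ss })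
                               (small? (C⊆A (here refl)) ×-dec All-dec C (C⊆A ∘ there))

  -- A walk either avoids `w` throughout or visits it, and then its final part joins `w` to `b`.
  Conn-∷ : ∀ {F w u b} → Conn E (w ∷ F) u b → Conn E F u b ⊎ Conn E (w ∷ F) w b
  Conn-∷ (here (here refl)) = inj₂ (here (here refl))
  Conn-∷ (here (there u∈F)) = inj₁ (here u∈F)
  Conn-∷ (step p (here refl) _) = inj₂ (here (here refl))
  Conn-∷ (step p (there c∈F) e) = Sum.map (λ q → step q c∈F e) (λ q → step q (there c∈F) e) (Conn-∷ p)

  -- Only the component of `w` is new: vertices whose walks miss `w` are already connected inside
  -- `F`.
  independent-∷ : ∀ {F w} → RIndependent E r F → Small (w ∷ F) w → RIndependent E r (w ∷ F)
  independent-∷ {F} {w} ind small u B B! conn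
    with All-⊎-const (All.map (λ p → Sum.map₂ (λ q → Conn-trans q (Conn-sym p)) (Conn-∷ p)) conn)
  ... | inj₁ connF = ind u B B! connF
  ... | inj₂ w⇝u   = small B B! (All.map (Conn-trans w⇝u) conn)

  Simplicial : V → Set
  Simplicial w = ∀ a b → T (E w a) → T (E w b) → a ≡ b ⊎ T (E a b)

  -- All neighbours of w in F lie in the component of v, so w can take the place of v there.
  exchange : ∀ {F v w z} → RIndependent E r (v ∷ F) → v ∉ F → Simplicial w →
             Conn E (v ∷ F) v z → T (E z w) → RIndependent E r (w ∷ F)
  exchange {F} {v} {w} {z} ind v∉F simp v⇝z zw = independent-∷ (independent-⊆ there ind) small
    where
    reach : ∀ {b} → Conn E (w ∷ F) w b → b ≡ w ⊎ Conn E (v ∷ F) v b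
    reach (here _) = inj₁ refl
    reach (step p (here refl) _) = inj₁ refl
    reach (step p (there c∈F) e) with reach p
    ... | inj₂ v⇝b  = inj₂ (step v⇝b (there c∈F) e)
    ... | inj₁ refl with simp _ _ (E-sym zw) e
    ...   | inj₁ refl = inj₂ v⇝z
    ...   | inj₂ zc   = inj₂ (step v⇝z (there c∈F) zc)
    small : Small (w ∷ F) w
    -- Exchanging `w` for `v` in `B` does not shorten the list and lands inside the component of `v`
    -- in `v ∷ F`.
    small B B! conn = ≤-trans (Unique-⊆-length B! (⊆-∷-remove B w))
      (ind v (v ∷ (B - w)) (Unique-∷ v∉ (remove! w B!)) (here (here refl) ∷ All.tabulate conn′))
      where
      conn′ : ∀ {b} → b ∈ B - w → Conn E (v ∷ F) v b
      conn′ b∈ = let b∈B , b≢w = ∈-remove⁻ b∈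
                 in  Sum.[ (λ b≡w → contradiction b≡w b≢w) , id ] (reach (All.lookup conn b∈B))
      v∉ : v ∉ B - w
      v∉ v∈ with v∈B , v≢w ← ∈-remove⁻ v∈ with Conn-target (All.lookup conn v∈B)
      ... | here v≡w  = v≢w v≡w
      ... | there v∈F = v∉F v∈F

  -- Replacement vertices and conditions on the vertex order.

  -- The edge found is the first one by which the walk leaves `D`, so its start `z` is still joined
  -- to `v` inside `D`.
  leave : ∀ {W D v b} → v ∈ D → Conn E W v b →
          Conn E D v b ⊎ ∃₂ λ z w → Conn E D v z × w ∈ W × w ∉ D × T (E z w)
  leave v∈D (here _) = inj₁ (here v∈D)
  leave {D = D} v∈D (step {w = w} p w∈W e) with leave v∈D p
  ... | inj₂ exit = inj₂ exit
  ... | inj₁ q with w ∈? D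
  ...   | yes w∈D = inj₁ (step q w∈D e)
  ...   | no w∉D  = inj₂ (_ , w , q , w∈W , w∉D , e)

  -- `N` stands for the undecided new vertices of the star-clique at `z`. With `z` they make at
  -- least r + 1 vertices, too many for a component of a face.
  Rich : List V → V → Set
  Rich U z = ∃ λ N → Unique N × r ≤ length N × (∀ {w} → w ∈ N → T (E z w) × Simplicial w × w ∈ U)

  Rich-mono : ∀ {U U′ z} → U ⊆ U′ → Rich U z → Rich U′ z
  Rich-mono U⊆U′ (N , N! , r≤ , nbr) =
    N , N! , r≤ , λ w∈N → let e , simp , w∈U = nbr w∈N in e , simp , U⊆U′ w∈U

  -- Were all of `N` in `D`, then `z ∷ N` would give more than r vertices in the component of `v`.
  rich-neighbour : ∀ {U D v z} → Small D v → Conn E D v z → Rich U z →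
                   ∃ λ w → w ∈ U × w ∉ D × Simplicial w × T (E z w)
  rich-neighbour {D = D} {z = z} small v⇝z (N , N! , r≤ , nbr) with any? (λ w → ¬? (w ∈? D)) N
  ... | yes found = let w , w∈N , w∉D = find found
                        e , simp , w∈U = nbr w∈N
                    in  w , w∈U , w∉D , simp , e
  ... | no none   = contradiction (small (z ∷ N) (Unique-∷ z∉N N!) (v⇝z ∷ All.tabulate conn)) (<⇒≱ (s≤s r≤))
    where
    z∉N : z ∉ N
    z∉N = E-irrefl ∘ proj₁ ∘ nbr
    conn : ∀ {w} → w ∈ N → Conn E D _ w
    conn {w} w∈N = step v⇝z
      (decidable-stable (w ∈? D) (λ w∉D → none (Any.map (λ { refl → w∉D }) w∈N)))
      (proj₁ (nbr w∈N))

  -- The two uses of a vertex `w` just outside a component: it is the replacement itself, or its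
  -- neighbour `z` inside the component supplies one.
  Exchangeable : List V → V → Set
  Exchangeable U w = Simplicial w ⊎ (∀ z → T (E z w) → Rich U z)

  -- A condition on the order alone: `v` is judged against the vertices after it, never against the
  -- face chosen so far, so one check serves all branches of the decomposition.
  data Suitable : List V → Set where
    []  : Suitable []
    _∷_ : ∀ {v U} → Rich U v ⊎ (∀ {w} → w ∈ U → Exchangeable U w) → Suitable U → Suitable (v ∷ U)

  open Decompositions _≟_ (IndR E r) independent? independent-⊆

  rich⇒shed : ∀ {U F v z} → RIndependent E r (v ∷ F) → v ∉ F → Conn E (v ∷ F) v z → Rich U z →
              ∃ λ w → w ∈ U × w ∉ F × RIndependent E r (w ∷ F)
  rich⇒shed ind v∉F v⇝z rich =
    let w , w∈U , w∉ , simp , zw = rich-neighbour (ind _) v⇝z rich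
    in  w , w∈U , w∉ ∘ there , exchange ind v∉F simp v⇝z zw

  -- If every walk stayed inside `v ∷ F`, this face would have a component with more than r
  -- vertices. So some walk leaves it, and the exit vertex, lying outside `T′ ⊆ F`, is undecided.
  large⇒shed : ∀ {T′ U F v} → (∀ {w} → w ∈ U → Exchangeable U w) → Large (v ∷ T′ ++ U) v →
               v ∉ F → T′ ⊆ F → RIndependent E r (v ∷ F) →
               ∃ λ w → w ∈ U × w ∉ F × RIndependent E r (w ∷ F)
  large⇒shed {T′} {U} {F} {v} exch (B , B! , conn , r<) v∉F T⊆F ind
    with All-⊎-const (All.map (leave {D = v ∷ F} (here refl)) conn)
  ... | inj₁ connD = contradiction (ind v B B! connD) (<⇒≱ r<)
  ... | inj₂ (z , w , v⇝z , w∈W , w∉D , zw) = cases w∈W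
    where
    in-U : w ∈ U → ∃ λ w → w ∈ U × w ∉ F × RIndependent E r (w ∷ F)
    in-U w∈U with exch w∈U
    ... | inj₁ simp = w , w∈U , w∉D ∘ there , exchange ind v∉F simp v⇝z zw
    ... | inj₂ rich = rich⇒shed ind v∉F v⇝z (rich z zw)
    cases : w ∈ v ∷ T′ ++ U → ∃ λ w → w ∈ U × w ∉ F × RIndependent E r (w ∷ F)
    cases (here refl) = contradiction (here refl) w∉D
    cases (there w∈)  = Sum.[ (λ w∈T → contradiction (there (T⊆F w∈T)) w∉D) , in-U ] (∈-++⁻ T′ w∈)

  decompose : ∀ T′ {U} → Unique U → (∀ {y} → y ∈ T′ → y ∉ U) → Suitable U → Decomposition T′ U
  decompose T′ [] _ [] = []
  decompose T′ {v ∷ U} (v≢ ∷ U!) disj (cond ∷ suit) = branch cond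
    where
    v∉T : v ∉ T′
    v∉T v∈T = disj v∈T (here refl)
    v∉U : v ∉ U
    v∉U v∈U = All.lookup v≢ v∈U refl
    d₁ : Decomposition T′ U
    d₁ = decompose T′ U! (λ y∈T → disj y∈T ∘ there) suit
    d₂ : Decomposition (v ∷ T′) U
    d₂ = decompose (v ∷ T′) U! (λ { (here refl) → v∉U ; (there y∈T) → disj y∈T ∘ there }) suit
    branch : Rich U v ⊎ (∀ {w} → w ∈ U → Exchangeable U w) → Decomposition T′ (v ∷ U)
    branch (inj₁ rich) = shed v∉T v∉U
      (λ btw ind → rich⇒shed ind (∉-between v∉T v∉U btw) (here (here refl)) rich) d₁ d₂
    -- The component is measured among all chosen and undecided vertices, so the outcome does not
    -- depend on `F`, as `cone` requires.
    branch (inj₂ exch) with small⊎large {v ∷ T′ ++ U} (here refl)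
    ... | inj₁ small = cone v∉T v∉U (λ (_ , F⊆) ind → independent-∷ ind
            (Small-mono (∷⁺ʳ _ (Sum.[ ∈-++⁺ˡ , ∈-++⁺ʳ T′ ] ∘ F⊆)) small)) d₂
    ... | inj₂ large = shed v∉T v∉U
            (λ btw → large⇒shed exch large (∉-between v∉T v∉U btw) (proj₁ btw)) d₁ d₂

  suitable⇒shellable : ∀ {U} → Unique U → (∀ v → v ∈ U) → Suitable U → Shellable (IndR E r)
  suitable⇒shellable U! U-total suit = decomposition⇒shellable U-total (decompose [] U! (λ ()) suit)

  suitable-simplicial : ∀ {U} → All Simplicial U → Suitable U
  suitable-simplicial []          = []
  suitable-simplicial (_ ∷ simps) = inj₂ (λ w∈ → inj₁ (All.lookup simps w∈)) ∷ suitable-simplicial simps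

  suitable-exchangeable-++ : ∀ {A U} → All (λ w → ∀ z → T (E z w) → Rich U z) A → All Simplicial U → Suitable (A ++ U)
  suitable-exchangeable-++ [] simps = suitable-simplicial simps
  suitable-exchangeable-++ {_ ∷ A} (_ ∷ rich) simps =
    inj₂ (λ w∈ → Sum.[ (λ w∈A → inj₂ (λ z e → Rich-mono (∈-++⁺ʳ A) (All.lookup rich w∈A z e)))
                     , (λ w∈U → inj₁ (All.lookup simps w∈U)) ] (∈-++⁻ A w∈))
    ∷ suitable-exchangeable-++ rich simps

  suitable-rich-++ : ∀ {A U} → All (Rich U) A → Suitable U → Suitable (A ++ U)
  suitable-rich-++ []               suit = suit
  suitable-rich-++ {_ ∷ A} (rich ∷ riches) suit =
    inj₁ (Rich-mono (∈-++⁺ʳ A) rich) ∷ suitable-rich-++ riches suit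

-- Lists concatenated from tabulated blocks.

∈-concat-tabulate⁺ : ∀ {A : Set} {m} (g : Fin m → List A) i {a} → a ∈ g i → a ∈ concat (tabulate g)
∈-concat-tabulate⁺ g i a∈ = ∈-concat⁺′ a∈ (∈-tabulate⁺ i)

∈-concat-tabulate⁻ : ∀ {A : Set} {m} (g : Fin m → List A) {a} → a ∈ concat (tabulate g) → ∃ λ i → a ∈ g i
∈-concat-tabulate⁻ g a∈ with ∈-concat⁻′ (tabulate g) a∈
... | _ , a∈gi , gi∈ with i , refl ← ∈-tabulate⁻ gi∈ = i , a∈gi

Unique-concat-tabulate : ∀ {A : Set} {m} (g : Fin m → List A) → (∀ i → Unique (g i)) →
  (∀ {i j a} → a ∈ g i → a ∈ g j → i ≡ j) → Unique (concat (tabulate g))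
Unique-concat-tabulate g g! inj = Unique.concat⁺ (All.tabulate⁺ g!)
  (AllPairs.tabulate⁺ (λ i≢j (a∈gi , a∈gj) → i≢j (inj a∈gi a∈gj)))

length-concat-tabulate : ∀ {A : Set} {m} (g : Fin m → List A) →
  length (concat (tabulate g)) ≡ sum (tabulate (length ∘ g))
length-concat-tabulate {m = zero}  g = refl
length-concat-tabulate {m = suc m} g =
  trans (length-++ (g zero)) (cong (length (g zero) +_) (length-concat-tabulate (g ∘ suc)))

-- The graph with attached star-cliques and its vertex order.

module StarCliques {n} (H : FinGraph n) (S : Subset n) (cover : IsVertexCover H S)
  (t : Fin n → ℕ) (k : (x : Fin n) → Fin (t x) → ℕ) (r : ℕ) (ccg : IsCCGData S r t k) where

  V : Set
  V = CCGVertex n t k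

  E : V → V → Bool
  E = ccgAdj H t k

  _≟_ : DecidableEquality V
  _≟_ = Sum.≡-dec Fin._≟_ (Product.≡-dec Fin._≟_ (Product.≡-dec Fin._≟_ Fin._≟_))

  -- A view of adjacency at a new vertex: matching on it fixes the indices and replaces the nested
  -- decisions in `ccgAdj`.
  data Neighbour (x : Fin n) (i : Fin (t x)) (a : Fin (k x i)) : V → Set where
    centre : Neighbour x i a (inj₁ x)
    peer   : ∀ {b} → a ≢ b → Neighbour x i a (inj₂ (x , i , b))

  E⇒neighbour : ∀ x i a v → T (E (inj₂ (x , i , a)) v) → Neighbour x i a v
  E⇒neighbour x i a (inj₁ u) e with refl ← toWitness {a? = x Fin.≟ u} e = centre
  E⇒neighbour x i a (inj₂ (y , j , b)) e with x Fin.≟ y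
  ... | yes refl with i Fin.≟ j
  ...   | yes refl with a Fin.≟ b
  ...     | no a≢b = peer a≢b

  E-centre : ∀ x i a → T (E (inj₁ x) (inj₂ (x , i , a)))
  E-centre x i a = fromWitness {a? = x Fin.≟ x} refl

  E-peer : ∀ x i {a b} → a ≢ b → T (E (inj₂ (x , i , a)) (inj₂ (x , i , b)))
  E-peer x i {a} {b} a≢b with x Fin.≟ x
  ... | no x≢x = x≢x refl
  ... | yes refl with i Fin.≟ i
  ...   | no i≢i = i≢i refl
  ...   | yes refl with a Fin.≟ b
  ...     | yes a≡b = a≢b a≡b
  ...     | no _    = _

  neighbour⇒E : ∀ {x i a v} → Neighbour x i a v → T (E v (inj₂ (x , i , a)))
  neighbour⇒E {x} {i} {a} centre     = E-centre x i a
  neighbour⇒E {x} {i}     (peer a≢b) = E-peer x i (a≢b ∘ sym)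

  E-sym : ∀ {u v} → T (E u v) → T (E v u)
  E-sym {inj₁ u} {inj₁ v} = subst T (FinGraph.sym H u v)
  E-sym {inj₁ u} {inj₂ (x , _)} e = fromWitness {a? = x Fin.≟ u} (sym (toWitness {a? = u Fin.≟ x} e))
  E-sym {inj₂ (x , i , a)} {v} e = neighbour⇒E (E⇒neighbour x i a v e)

  E-irrefl : ∀ {v} → ¬ T (E v v)
  E-irrefl {inj₁ v} = subst T (FinGraph.irrefl H v)
  E-irrefl {inj₂ (x , i , a)} e with peer a≢a ← E⇒neighbour x i a (inj₂ (x , i , a)) e = a≢a refl

  open IndependenceComplex _≟_ E (λ {u} {v} → E-sym {u} {v}) (λ {v} → E-irrefl {v}) r

  -- All neighbours of a new vertex lie in the single clique that contains it.
  new-simplicial : ∀ p → Simplicial (inj₂ p)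
  new-simplicial (x , i , a) u v e e′ with E⇒neighbour x i a u e | E⇒neighbour x i a v e′
  ... | centre | centre = inj₁ refl
  ... | centre | peer {c} _ = inj₂ (E-centre x i c)
  ... | peer {b} _ | centre = inj₂ (E-sym {inj₁ x} {inj₂ (x , i , b)} (E-centre x i b))
  ... | peer {b} _ | peer {c} _ with b Fin.≟ c
  ...   | yes refl = inj₁ refl
  ...   | no b≢c   = inj₂ (E-peer x i b≢c)

  clique : ∀ x → Fin (t x) → List V
  clique x i = tabulate (λ a → inj₂ (x , i , a))

  star : Fin n → List V
  star x = concat (tabulate (clique x))

  stars : List V
  stars = concat (tabulate star)

  ∈-star⁻ : ∀ {x v} → v ∈ star x → ∃₂ λ i a → v ≡ inj₂ (x , i , a)
  ∈-star⁻ {x} v∈ with i , v∈ᵢ ← ∈-concat-tabulate⁻ (clique x) v∈ = i , ∈-tabulate⁻ v∈ᵢ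

  star! : ∀ x → Unique (star x)
  star! x = Unique-concat-tabulate (clique x) (λ _ → Unique.tabulate⁺ λ { refl → refl }) same
    where
    same : ∀ {i j v} → v ∈ clique x i → v ∈ clique x j → i ≡ j
    same v∈ᵢ v∈ⱼ with _ , refl ← ∈-tabulate⁻ v∈ᵢ with _ , refl ← ∈-tabulate⁻ v∈ⱼ = refl

  length-star : ∀ x → length (star x) ≡ sum (tabulate (k x))
  length-star x = trans (length-concat-tabulate (clique x)) (cong sum (tabulate-cong λ i →
    length-tabulate {A = V} (λ a → inj₂ (x , i , a))))

  stars! : Unique stars
  stars! = Unique-concat-tabulate star star! same
    where
    same : ∀ {x y v} → v ∈ star x → v ∈ star y → x ≡ y
    same v∈ₓ v∈ᵧ with _ , _ , refl ← ∈-star⁻ v∈ₓ with _ , _ , refl ← ∈-star⁻ v∈ᵧ = refl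

  ∈-stars⁺ : ∀ p → inj₂ p ∈ stars
  ∈-stars⁺ (x , i , a) = ∈-concat-tabulate⁺ star x (∈-concat-tabulate⁺ (clique x) i (∈-tabulate⁺ a))

  ∈-stars⁻ : ∀ {v} → v ∈ stars → ∃ λ p → v ≡ inj₂ p
  ∈-stars⁻ v∈ with x , v∈ₓ ← ∈-concat-tabulate⁻ star v∈ with i , a , eq ← ∈-star⁻ v∈ₓ = (x , i , a) , eq

  rich : ∀ {x} → x ∈ˢ S → Rich stars (inj₁ x)
  rich {x} x∈S = star x , star! x
    -- The bound r + 1 counts the centre; without it at least r new vertices remain.
    , ≤-pred (subst (_≤ 1 + length (star x)) (+-comm r 1)
        (subst (λ m → r + 1 ≤ 1 + m) (sym (length-star x)) (proj₂ ccg x x∈S)))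
    , nbr
    where
    nbr : ∀ {w} → w ∈ star x → T (E (inj₁ x) w) × Simplicial w × w ∈ stars
    nbr w∈ with i , a , refl ← ∈-star⁻ w∈ = E-centre x i a , new-simplicial _ , ∈-stars⁺ _

  rich-neighbours : ∀ {y} → y ∉ˢ S → ∀ z → T (E z (inj₁ y)) → Rich stars z
  rich-neighbours {y} y∉S (inj₁ z) e with cover z y e
  ... | inj₁ z∈S = rich z∈S
  ... | inj₂ y∈S = contradiction y∈S y∉S
  -- A new neighbour of `y` would be attached at `y` itself, but `t y` is 0 outside `S`, so there is
  -- no clique index `i`.
  rich-neighbours {y} y∉S (inj₂ (x , i , a)) e with centre ← E⇒neighbour x i a (inj₁ y) e
    with () ← subst Fin (proj₁ ccg x y∉S) i

  covered uncovered : List (Fin n)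
  covered   = filter (_∈ˢ? S) (allFin n)
  uncovered = filter (λ x → ¬? (x ∈ˢ? S)) (allFin n)

  -- New vertices come last so that every star is still undecided when the vertices of `H` are
  -- treated. `S` comes first because a vertex outside `S` needs its whole tail to be exchangeable,
  -- which is not guaranteed for vertices of `S`.
  order : List V
  order = map inj₁ covered ++ map inj₁ uncovered ++ stars

  ∈-order : ∀ v → v ∈ order
  ∈-order (inj₂ p) = ∈-++⁺ʳ (map inj₁ covered) (∈-++⁺ʳ (map inj₁ uncovered) (∈-stars⁺ p))
  ∈-order (inj₁ x) with x ∈ˢ? S
  ... | yes x∈S = ∈-++⁺ˡ (∈-map⁺ inj₁ (∈-filter⁺ (_∈ˢ? S) (∈-allFin x) x∈S))
  ... | no x∉S  = ∈-++⁺ʳ (map inj₁ covered)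
          (∈-++⁺ˡ (∈-map⁺ inj₁ (∈-filter⁺ (λ x → ¬? (x ∈ˢ? S)) (∈-allFin x) x∉S)))

  order! : Unique order
  order! = Unique.++⁺ (old! (_∈ˢ? S))
    (Unique.++⁺ (old! (λ x → ¬? (x ∈ˢ? S))) stars! (λ (v∈ , v∈′) → old≢new v∈ v∈′))
    disjoint
    where
    old! : ∀ {P : Fin n → Set} (P? : ∀ x → Dec (P x)) → Unique {A = V} (map inj₁ (filter P? (allFin n)))
    old! P? = Unique.map⁺ Sum.inj₁-injective (Unique.filter⁺ P? (Unique.allFin⁺ n))
    old≢new : ∀ {v xs} → v ∈ map inj₁ xs → ¬ v ∈ stars
    old≢new v∈ v∈′ with _ , _ , refl ← ∈-map⁻ inj₁ v∈ with _ , () ← ∈-stars⁻ v∈′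
    disjoint : ∀ {v} → ¬ (v ∈ map inj₁ covered × v ∈ map inj₁ uncovered ++ stars)
    disjoint (v∈ , v∈′) with ∈-++⁻ (map inj₁ uncovered) v∈′
    ... | inj₂ v∈stars = old≢new v∈ v∈stars
    ... | inj₁ v∈unc with x , x∈ , refl ← ∈-map⁻ inj₁ v∈ with _ , x∈′ , refl ← ∈-map⁻ inj₁ v∈unc =
      proj₂ (∈-filter⁻ (λ x → ¬? (x ∈ˢ? S)) {xs = allFin n} x∈′)
            (proj₂ (∈-filter⁻ (_∈ˢ? S) {xs = allFin n} x∈))

  order-suitable : Suitable order
  order-suitable = suitable-rich-++
    (All.map⁺ (All.tabulate λ {x} x∈ → Rich-mono {z = inj₁ x} (∈-++⁺ʳ (map inj₁ uncovered))
      (rich (proj₂ (∈-filter⁻ (_∈ˢ? S) {xs = allFin n} x∈)))))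
    (suitable-exchangeable-++
      (All.map⁺ (All.tabulate λ x∈ →
        rich-neighbours (proj₂ (∈-filter⁻ (λ x → ¬? (x ∈ˢ? S)) {xs = allFin n} x∈))))
      (All.tabulate stars-simplicial))
    where
    stars-simplicial : ∀ {v} → v ∈ stars → Simplicial v
    stars-simplicial v∈ with p , refl ← ∈-stars⁻ v∈ = new-simplicial p

  shellable : Shellable (IndR E r)
  shellable = suitable⇒shellable order! ∈-order order-suitable

theorem5p1 : (r : ℕ) → 1 ≤ r → (n : ℕ) (H : FinGraph n) (S : Subset n) →
    IsVertexCover H S →
    (t : Fin n → ℕ) (k : (x : Fin n) → Fin (t x) → ℕ) →
    IsCCGData S r t k →
    Shellable (IndR (ccgAdj H t k) r)
theorem5p1 r _ n H S cover t k ccg = StarCliques.shellable H S cover t k r ccg
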